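{- Let $s$ be a string of length $n$ over an alphabet of size $\sigma\ge 2$ (consisting of non-negative integers at most $n$), and let $\mathsf{LZ_{opt}}$ be the size in bits of an optimal LZ77 encoding of $s$. Then $\mathsf{LZ_{opt}} = \Omega(\log n + z\log\log_\sigma z)$, where $z$ is the number of phrases in the greedy LZ77 parsing of $s$.
   Context: An LZ77 parsing of $s$ is a factorization $s=f_1\cdots f_z$ into non-empty phrases such that each $f_i$ is either a single letter, or $|f_i|>1$ and $f_i[1..|f_i|-1]$ has an occurrence starting at some position $j\le|f_1\cdots f_{i-1}|$ (possibly overlapping $f_i$). The greedy LZ77 parsing chooses, from left to right, each phrase as long as possible subject to this condition. An LZ77 encoding of a parsing represents each phrase $f_i$ by a triple $\langle d,\ell,c\rangle$ with $\ell=|f_i|$, $c$ the last letter of $f_i$, and $d=|f_1\cdots f_{i-1}|-j$ for a position $j$ of an earlier occurrence of $f_i[1..|f_i|-1]$ ($d=0$ if $|f_i|=1$); the triple is written as $e_d(d)e_\ell(\ell)e_c(c)$ and these bit strings are concatenated. Here $e_d,e_\ell,e_c$ are fixed encoders mapping non-negative integers to bit strings such that every positive integer $x$ is mapped to a bit string of length $\Theta(\log(x+1))$. An optimal LZ77 encoding is one of minimal size in bits over all LZ77 parsings of $s$ and all admissible choices of the values $d$. Logarithms are base 2 unless a base is indicated. -}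

module Defs where

open import Data.Nat using (ℕ; zero; suc; _+_; _*_; _∸_; _^_; _≤_; _<_; _≤?_)
open import Data.Nat.Logarithm using (⌊log₂_⌋)
open import Data.Bool using (Bool)
open import Data.List using (List; []; _∷_; _++_; take; drop; length; filter; upTo; map)
open import Data.List.Relation.Unary.All using (All)
open import Data.List.Relation.Unary.Unique.Propositional using (Unique)
open import Data.List.Membership.Propositional using (_∈_)
open import Data.Product using (Σ; ∃; _×_; _,_)
open import Data.Sum using (_⊎_)
open import Relation.Binary.PropositionalEquality using (_≡_)

-- Strings are lists of naturals, 0-indexed: position p of s is the head of drop p s.
-- A phrase starting at 0-indexed position p has |f_1 ... f_{i-1}| = p.

-- An LZ77 triple ⟨d , ℓ , c⟩.
Triple : Set
Triple = ℕ × ℕ × ℕ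

-- ValidTriple s p t : the triple t encodes an admissible LZ77 phrase of s
-- starting at (0-indexed) position p.
--  * literal: ℓ = 1, d = 0, c = s[p];
--  * copy:    ℓ ≥ 2, the phrase s[p .. p+ℓ-1] lies inside s, c is its last letter,
--             and its first ℓ-1 letters occur at the 1-indexed position j = p - d
--             (i.e. 0-indexed position p ∸ suc d), where d < p, i.e. 1 ≤ j ≤ p.
ValidTriple : List ℕ → ℕ → Triple → Set
ValidTriple s p (d , ℓ , c) =
    (ℓ ≡ 1 × d ≡ 0 × take 1 (drop p s) ≡ c ∷ [])
  ⊎ (2 ≤ ℓ × p + ℓ ≤ length s × d < p
     × take (ℓ ∸ 1) (drop (p ∸ suc d) s) ≡ take (ℓ ∸ 1) (drop p s)
     × take 1 (drop (p + ℓ ∸ 1) s) ≡ c ∷ [])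

ValidPhrase : List ℕ → ℕ → ℕ → Set
ValidPhrase s p ℓ = ∃ λ d → ∃ λ c → ValidTriple s p (d , ℓ , c)

data LZEnc (s : List ℕ) : ℕ → List Triple → Set where
  done : LZEnc s (length s) []
  step : ∀ {p d ℓ c ts} → ValidTriple s p (d , ℓ , c)
       → LZEnc s (p + ℓ) ts → LZEnc s p ((d , ℓ , c) ∷ ts)

LZ77Encoding : List ℕ → List Triple → Set
LZ77Encoding s ts = LZEnc s 0 ts

data Greedy (s : List ℕ) : ℕ → List ℕ → Set where
  done : Greedy s (length s) []
  step : ∀ {p ℓ ls} → ValidPhrase s p ℓ
       → (∀ ℓ' → ValidPhrase s p ℓ' → ℓ' ≤ ℓ)
       → Greedy s (p + ℓ) ls → Greedy s p (ℓ ∷ ls)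

GreedyParsing : List ℕ → List ℕ → Set
GreedyParsing s ls = Greedy s 0 ls

encSize : (ℕ → List Bool) → (ℕ → List Bool) → (ℕ → List Bool) → List Triple → ℕ
encSize ed eℓ ec [] = 0
encSize ed eℓ ec ((d , ℓ , c) ∷ ts) =
  length (ed d) + length (eℓ ℓ) + length (ec c) + encSize ed eℓ ec ts

-- e maps every positive x to a bit string of length Θ(log (x+1)).
-- (For x ≥ 1, log(x+1) ≥ 1, so ⌊log₂(x+1)⌋ is within a factor 2 of log₂(x+1).)
ThetaLogEncoder : (ℕ → List Bool) → Set
ThetaLogEncoder e = ∃ λ a → ∃ λ b → ∀ x → 1 ≤ x →
  (⌊log₂ (suc x) ⌋ ≤ a * length (e x)) × (length (e x) ≤ b * ⌊log₂ (suc x) ⌋)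

-- ⌊log_b x⌋ for b ≥ 2 and x ≥ 1: the number of t ∈ {1,…,x} with b^t ≤ x
-- (since b^t is increasing and b^t > x for t > x, this is the largest t with b^t ≤ x).
⌊log[_]_⌋ : ℕ → ℕ → ℕ
⌊log[ b ] x ⌋ = length (filter (λ t → b ^ t ≤? x) (map suc (upTo x)))

Alphabet : ℕ → ℕ → List ℕ → List ℕ → Set
Alphabet n σ A s = Unique A × length A ≡ σ × All (_≤ n) A × All (_∈ A) s

module Submission where

-- Only the length encoder e_ℓ is needed: its
-- logarithmic lower bound turns into a weight w ℓ = (a + 1)·|e_ℓ(ℓ)| with ℓ + 1 ≤ 2 ^ w ℓ
-- (encoder-bits), and the total weight W of an encoding is at most (a + 1) times its size.
--  * log n ≤ W, since the product of the ℓ + 1 over all phrases is at least n + 1.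
--  * A greedy phrase never ends strictly inside an admissible phrase starting before it
--    (straddle-covered), so each encoding phrase overlaps at most two greedy phrases, while
--    a greedy phrase of length ≥ 2^(t-1) collects weight ≥ t: t·#long ≤ 2W (Charging).
--  * Greedy phrases other than the last are pairwise distinct words, since a repeated one
--    could be extended (innerPhrases-unique); so fewer than σ^T have length < T.
--  * For t = ⌊log₂ ⌊log_σ z⌋⌋ and T = 2^(t-1), u = σ^T satisfies t ≤ u and u·u ≤ z, and the
--    three facts combine to z·t ≤ 6W (Counting.loglog-count); hence k = 7(a + 1), n₀ = 0.
-- The file develops logarithms, admissible phrases, distinctness of greedy phrases, counting
-- words, the charging argument, and the phrase count, and concludes with the theorem.

open import Defs
open import Data.Bool using (Bool)
open import Data.List using (List; []; _∷_; _++_; take; drop; length; map; filter; applyUpTo; cartesianProductWith)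
open import Data.List.Properties using (filter-accept; filter-reject; filter-all; map-applyUpTo; length-take; length-drop; take-take; take-drop; drop-drop; length-++; length-++-sucʳ; length-map)
open import Data.List.Membership.Propositional using (_∈_)
open import Data.List.Membership.Propositional.Properties using (∈-cartesianProductWith⁺; ∈-++⁺ˡ; ∈-++⁺ʳ; ∈-++⁻; ∈-∃++)
open import Data.List.Relation.Unary.All as All using (All; []; _∷_)
open import Data.List.Relation.Unary.All.Properties using (take⁺; drop⁺; all-filter) renaming (filter⁺ to All-filter⁺)
open import Data.List.Relation.Unary.Unique.Propositional.Properties using () renaming (filter⁺ to Unique-filter⁺)
open import Data.List.Relation.Unary.Any using (here; there)
open import Data.List.Relation.Unary.AllPairs using ([]; _∷_)
open import Data.List.Relation.Unary.Unique.Propositional using (Unique)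
open import Data.Sum using (inj₁; inj₂)
open import Data.Nat
open import Data.Nat.Properties
open import Data.Nat.Logarithm using (⌊log₂_⌋; ⌊log₂⌋-mono-≤; ⌊log₂[2^n]⌋≡n)
open import Data.Nat.Logarithm.Core using (⌊log2⌋)
open import Data.Nat.Tactic.RingSolver using (solve-∀)
open import Data.Product using (∃; _×_; _,_; proj₁; proj₂)
open import Induction.WellFounded using (Acc; acc)
open import Relation.Binary.PropositionalEquality
open import Relation.Nullary using (yes; no)
open import Relation.Unary using (Pred; Decidable)
open import Level using (0ℓ)
open import Data.Empty using (⊥-elim)
open import Function using (_∘_)

2^⌊log2⌋≤ : ∀ x (rec : Acc _<_ x) → 1 ≤ x → 2 ^ ⌊log2⌋ x rec ≤ x
2^⌊log2⌋≤ 1 _ _ = ≤-refl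
2^⌊log2⌋≤ (suc (suc n)) (acc rs) _ = begin
  2 * 2 ^ ⌊log2⌋ (suc h) _  ≤⟨ *-monoʳ-≤ 2 (2^⌊log2⌋≤ (suc h) _ (s≤s z≤n)) ⟩
  2 * suc h                 ≡⟨ *-suc 2 h ⟩
  2 + (h + (h + 0))         ≤⟨ +-monoʳ-≤ 2 (+-monoʳ-≤ h (≤-trans (≤-reflexive (+-identityʳ h)) (⌊n/2⌋≤⌈n/2⌉ n))) ⟩
  2 + (h + ⌈ n /2⌉)         ≡⟨ cong (2 +_) (⌊n/2⌋+⌈n/2⌉≡n n) ⟩
  suc (suc n)               ∎
  where
  open ≤-Reasoning
  h = ⌊ n /2⌋

2^⌊log₂⌋≤ : ∀ x → 1 ≤ x → 2 ^ ⌊log₂ x ⌋ ≤ x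
2^⌊log₂⌋≤ x = 2^⌊log2⌋≤ x _

<2^suc⌊log₂⌋ : ∀ x → x < 2 ^ suc ⌊log₂ x ⌋
<2^suc⌊log₂⌋ x with 2 ^ suc ⌊log₂ x ⌋ ≤? x
... | no 2^k≰x = ≰⇒> 2^k≰x
... | yes 2^k≤x = ⊥-elim (n≮n k (begin-strict
  k                   <⟨ n<1+n k ⟩
  suc k               ≡⟨ ⌊log₂[2^n]⌋≡n (suc k) ⟨
  ⌊log₂ 2 ^ suc k ⌋   ≤⟨ ⌊log₂⌋-mono-≤ 2^k≤x ⟩
  k                   ∎))
  where
  open ≤-Reasoning
  k = ⌊log₂ x ⌋

filter-enumeration-large : ∀ {P : Pred ℕ 0ℓ} (P? : Decidable P) n f b k → (∀ i → b + i ≤ f i)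
  → length (filter P? (applyUpTo f n)) ≡ suc k → ∃ λ y → P y × b + k ≤ y
filter-enumeration-large P? (suc n) f b k f-large len≡ with P? (f 0) | k
... | no _    | k      =
  let y , Py , 1+b+k≤y = filter-enumeration-large P? n (f ∘ suc) (suc b) k tail-large len≡
  in y , Py , ≤-trans (n≤1+n _) 1+b+k≤y
  where tail-large = λ i → subst (_≤ f (suc i)) (+-suc b i) (f-large (suc i))
... | yes Pf0 | zero   = f 0 , Pf0 , f-large 0
... | yes _   | suc k′ =
  let y , Py , 1+b+k′≤y = filter-enumeration-large P? n (f ∘ suc) (suc b) k′ tail-large (suc-injective len≡)
  in y , Py , subst (_≤ y) (sym (+-suc b k′)) 1+b+k′≤y
  where tail-large = λ i → subst (_≤ f (suc i)) (+-suc b i) (f-large (suc i))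

σ^⌊log[σ]⌋≤ : ∀ σ z .{{_ : NonZero σ}} → 1 ≤ ⌊log[ σ ] z ⌋ → σ ^ ⌊log[ σ ] z ⌋ ≤ z
σ^⌊log[σ]⌋≤ σ z 1≤L with ⌊log[ σ ] z ⌋ in L≡
... | suc k =
  let y , σ^y≤z , 1+k≤y = filter-enumeration-large P? z suc 1 k (λ _ → ≤-refl) enumeration
  in ≤-trans (^-monoʳ-≤ σ 1+k≤y) σ^y≤z
  where
  P? = λ t → σ ^ t ≤? z
  enumeration : length (filter P? (applyUpTo suc z)) ≡ suc k
  enumeration = trans (cong (length ∘ filter P?) (sym (map-applyUpTo (λ i → i) suc z))) L≡

⌊log₂⌋-positive : ∀ x → 1 ≤ ⌊log₂ x ⌋ → 1 ≤ x
⌊log₂⌋-positive (suc x) _ = s≤s z≤n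

square-below : ∀ σ z t′ .{{_ : NonZero σ}} → ⌊log₂ ⌊log[ σ ] z ⌋ ⌋ ≡ suc t′ → σ ^ 2 ^ t′ * σ ^ 2 ^ t′ ≤ z
square-below σ z t′ t≡ = begin
  σ ^ T * σ ^ T       ≡⟨ ^-distribˡ-+-* σ T T ⟨
  σ ^ (T + T)         ≡⟨ cong (λ x → σ ^ (T + x)) (+-identityʳ T) ⟨
  σ ^ 2 ^ suc t′      ≡⟨ cong (λ x → σ ^ 2 ^ x) t≡ ⟨
  σ ^ 2 ^ ⌊log₂ L ⌋   ≤⟨ ^-monoʳ-≤ σ (2^⌊log₂⌋≤ L 1≤L) ⟩
  σ ^ L               ≤⟨ σ^⌊log[σ]⌋≤ σ z 1≤L ⟩
  z                   ∎
  where
  open ≤-Reasoning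
  T = 2 ^ t′
  L = ⌊log[ σ ] z ⌋
  1≤L : 1 ≤ L
  1≤L = ⌊log₂⌋-positive L (subst (1 ≤_) (sym t≡) (s≤s z≤n))

n<2^n : ∀ n → n < 2 ^ n
n<2^n zero    = s≤s z≤n
n<2^n (suc n) = +-mono-≤ (m^n>0 2 n) (≤-trans (n<2^n n) (≤-reflexive (sym (+-identityʳ (2 ^ n)))))

letter⇒inside : ∀ p (s : List ℕ) {c} → take 1 (drop p s) ≡ c ∷ [] → p < length s
letter⇒inside zero    (_ ∷ _) _ = s≤s z≤n
letter⇒inside (suc p) (_ ∷ s) e = s≤s (letter⇒inside p s e)

inside⇒letter : ∀ p (s : List ℕ) → p < length s → ∃ λ c → take 1 (drop p s) ≡ c ∷ []
inside⇒letter zero    (x ∷ _) _         = x , refl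
inside⇒letter (suc p) (_ ∷ s) (s≤s p<) = inside⇒letter p s p<

triple-bounds : ∀ {s p d ℓ c} → ValidTriple s p (d , ℓ , c) → 1 ≤ ℓ × p + ℓ ≤ length s
triple-bounds {s} {p} (inj₁ (refl , refl , e)) = s≤s z≤n , subst (_≤ length s) (+-comm 1 p) (letter⇒inside p s e)
triple-bounds (inj₂ (2≤ℓ , inside , _)) = ≤-trans (s≤s z≤n) 2≤ℓ , inside

phrase-bounds : ∀ {s p ℓ} → ValidPhrase s p ℓ → 1 ≤ ℓ × p + ℓ ≤ length s
phrase-bounds (_ , _ , vt) = triple-bounds vt

take-agree-drop : ∀ k n (xs ys : List ℕ) → take (k + n) xs ≡ take (k + n) ys
  → take n (drop k xs) ≡ take n (drop k ys)
take-agree-drop k n xs ys eq = begin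
  take n (drop k xs)      ≡⟨ take-drop n k xs ⟩
  drop k (take (k + n) xs) ≡⟨ cong (drop k) eq ⟩
  drop k (take (k + n) ys) ≡⟨ take-drop n k ys ⟨
  take n (drop k ys)      ∎
  where open ≡-Reasoning

take-prefix : ∀ {n m} (xs : List ℕ) → n ≤ m → take n (take m xs) ≡ take n xs
take-prefix {n} {m} xs n≤m = trans (take-take n m xs) (cong (λ j → take j xs) (m≤n⇒m⊓n≡m n≤m))

-- A suffix of length m ≥ 2 of an admissible copy phrase is again admissible, with the
-- same distance d (its source is the corresponding suffix of the original source).
suffix-valid : ∀ {s p d c} k m → 2 ≤ m → ValidTriple s p (d , k + m , c)
  → ValidTriple s (p + k) (d , m , c)
suffix-valid k m 2≤m (inj₁ (k+m≡1 , _)) =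
  ⊥-elim (<⇒≱ 2≤m (≤-trans (m≤n+m m k) (≤-reflexive k+m≡1)))
suffix-valid {s} {p} {d} {c} k (suc m) 2≤m (inj₂ (_ , inside , d<p , source , last)) =
  inj₂ (2≤m , subst (_≤ length s) (sym (+-assoc p k (suc m))) inside , ≤-trans d<p (m≤m+n p k) ,
        source′ , subst (λ j → take 1 (drop (j ∸ 1) s) ≡ c ∷ []) (sym (+-assoc p k (suc m))) last)
  where
  j = p ∸ suc d
  source′ : take m (drop (p + k ∸ suc d) s) ≡ take m (drop (p + k) s)
  source′ = begin
    take m (drop (p + k ∸ suc d) s) ≡⟨ cong (λ x → take m (drop x s)) (+-∸-comm k d<p) ⟩
    take m (drop (j + k) s)         ≡⟨ cong (take m) (drop-drop j k s) ⟨
    take m (drop k (drop j s))      ≡⟨ take-agree-drop k m _ _ (subst (λ x → take (x ∸ 1) (drop j s) ≡ take (x ∸ 1) (drop p s)) (+-suc k m) source) ⟩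
    take m (drop k (drop p s))      ≡⟨ cong (take m) (drop-drop p k s) ⟩
    take m (drop (p + k) s)         ∎
    where open ≡-Reasoning

-- Greedy phrases absorb straddling phrases: if an admissible phrase occupies [p, p + ℓ)
-- and a greedy phrase of maximal length g starts at e with p < e < p + ℓ, then the tail
-- of the first phrase from e is admissible at e, so p + ℓ ≤ e + g.
straddle-covered : ∀ {s p d ℓ c e g} → ValidTriple s p (d , ℓ , c) → p < e → e < p + ℓ
  → 1 ≤ g → (∀ ℓ′ → ValidPhrase s e ℓ′ → ℓ′ ≤ g) → p + ℓ ≤ e + g
straddle-covered {s} {p} {d} {ℓ} {c} {e} {g} vt p<e e<end 1≤g maximal
  with m≤n⇒∃[o]m+o≡n (<⇒≤ p<e) | m≤n⇒∃[o]m+o≡n e<end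
... | k , refl | m , end≡ = subst (_≤ p + k + g) (trans (+-suc (p + k) m) end≡) (+-monoʳ-≤ (p + k) (tail≤g m ℓ≡))
  where
  ℓ≡ : ℓ ≡ k + suc m
  ℓ≡ = +-cancelˡ-≡ p ℓ (k + suc m) (trans (sym end≡) (trans (sym (+-suc (p + k) m)) (+-assoc p k (suc m))))
  tail≤g : ∀ m → ℓ ≡ k + suc m → suc m ≤ g
  tail≤g zero     _    = 1≤g
  tail≤g (suc m′) refl = maximal (suc (suc m′)) (d , c , suffix-valid k (suc (suc m′)) (s≤s (s≤s z≤n)) vt)

length-window : ∀ g q (s : List ℕ) → q + g ≤ length s → length (take g (drop q s)) ≡ g
length-window g q s inside = trans (length-take g (drop q s)) (m≤n⇒m⊓n≡m g≤rest)
  where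
  g≤rest : g ≤ length (drop q s)
  g≤rest = subst (g ≤_) (sym (length-drop q s))
             (subst (_≤ length s ∸ q) (m+n∸m≡n q g) (∸-monoˡ-≤ q inside))

repeat-extends : ∀ {s q0 g0 q g} → q0 < q → 1 ≤ g → q + g < length s
  → take g0 (drop q0 s) ≡ take g (drop q s) → ValidPhrase s q (suc g)
repeat-extends {s} {q0} {g0} {q} {g} q0<q 1≤g q+g<n repeat =
  d , c , inj₂ (s≤s 1≤g , subst (_≤ length s) (sym (+-suc q g)) q+g<n , d<q , source , last)
  where
  d = q ∸ suc q0
  d<q : d < q
  d<q = ∸-monoʳ-< (s≤s z≤n) q0<q
  q∸[1+d]≡q0 : q ∸ suc d ≡ q0
  q∸[1+d]≡q0 = trans (cong (q ∸_) (sym (+-∸-assoc 1 q0<q))) (m∸[m∸n]≡n (<⇒≤ q0<q))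
  g≤g0 : g ≤ g0
  g≤g0 = begin
    g                            ≡⟨ length-window g q s (<⇒≤ q+g<n) ⟨
    length (take g (drop q s))   ≡⟨ cong length repeat ⟨
    length (take g0 (drop q0 s)) ≡⟨ length-take g0 (drop q0 s) ⟩
    g0 ⊓ length (drop q0 s)      ≤⟨ m⊓n≤m g0 _ ⟩
    g0                           ∎
    where open ≤-Reasoning
  source : take g (drop (q ∸ suc d) s) ≡ take g (drop q s)
  source = begin
    take g (drop (q ∸ suc d) s)   ≡⟨ cong (λ x → take g (drop x s)) q∸[1+d]≡q0 ⟩
    take g (drop q0 s)            ≡⟨ take-prefix (drop q0 s) g≤g0 ⟨
    take g (take g0 (drop q0 s))  ≡⟨ cong (take g) repeat ⟩
    take g (take g (drop q s))    ≡⟨ take-prefix (drop q s) ≤-refl ⟩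
    take g (drop q s)             ∎
    where open ≡-Reasoning
  c = proj₁ (inside⇒letter (q + g) s q+g<n)
  last : take 1 (drop (q + suc g ∸ 1) s) ≡ c ∷ []
  last = subst (λ x → take 1 (drop (x ∸ 1) s) ≡ c ∷ []) (sym (+-suc q g)) (proj₂ (inside⇒letter (q + g) s q+g<n))

greedy-starts-inside : ∀ {s p g gs} → Greedy s p (g ∷ gs) → p < length s
greedy-starts-inside {p = p} (step vp _ _) = <-≤-trans (m<m+n p 1≤g) inside
  where
  1≤g = proj₁ (phrase-bounds vp)
  inside = proj₂ (phrase-bounds vp)

greedy-nonempty : ∀ {s q ls} → Greedy s q ls → All (1 ≤_) ls
greedy-nonempty done             = []
greedy-nonempty (step vp _ rest) = proj₁ (phrase-bounds vp) ∷ greedy-nonempty rest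

innerPhrases : List ℕ → ℕ → List ℕ → List (List ℕ)
innerPhrases s q []               = []
innerPhrases s q (g ∷ [])         = []
innerPhrases s q (g ∷ gs@(_ ∷ _)) = take g (drop q s) ∷ innerPhrases s (q + g) gs

-- Any window starting before a greedy suffix parsing differs from each of its inner
-- phrases: otherwise that phrase could be extended (repeat-extends), contradicting maximality.
earlier-differs : ∀ {s q0 g0 q ls} → Greedy s q ls → q0 < q
  → All (take g0 (drop q0 s) ≢_) (innerPhrases s q ls)
earlier-differs done _ = []
earlier-differs (step {ls = []} _ _ _) _ = []
earlier-differs {q = q} (step {ℓ = g} {ls = _ ∷ _} vp maximal rest) q0<q =
  (λ repeat → 1+n≰n (maximal (suc g) (repeat-extends q0<q (proj₁ (phrase-bounds vp)) (greedy-starts-inside rest) repeat)))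
  ∷ earlier-differs rest (≤-trans q0<q (m≤m+n q g))

innerPhrases-unique : ∀ {s q ls} → Greedy s q ls → Unique (innerPhrases s q ls)
innerPhrases-unique done = []
innerPhrases-unique (step {ls = []} _ _ _) = []
innerPhrases-unique {q = q} (step {ls = _ ∷ _} vp _ rest) =
  earlier-differs rest (m<m+n q (proj₁ (phrase-bounds vp))) ∷ innerPhrases-unique rest

prefixLetters : List ℕ → List (List ℕ) → List (List ℕ)
prefixLetters = cartesianProductWith _∷_

length-prefixLetters : ∀ A ws → length (prefixLetters A ws) ≡ length A * length ws
length-prefixLetters []      ws = refl
length-prefixLetters (a ∷ A) ws =
  trans (length-++ (map (a ∷_) ws)) (cong₂ _+_ (length-map (a ∷_) ws) (length-prefixLetters A ws))

words≤ : List ℕ → ℕ → List (List ℕ)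
words≤ A zero    = [] ∷ []
words≤ A (suc k) = [] ∷ prefixLetters A (words≤ A k)

words≤-count : ∀ A k → 2 ≤ length A → suc (length (words≤ A k)) ≤ length A ^ suc k
words≤-count A zero    2≤σ = subst (2 ≤_) (sym (*-identityʳ (length A))) 2≤σ
words≤-count A (suc k) 2≤σ = begin
  2 + length (prefixLetters A W)            ≡⟨ cong (2 +_) (length-prefixLetters A W) ⟩
  2 + σ * length W                          ≤⟨ +-monoˡ-≤ (σ * length W) 2≤σ ⟩
  σ + σ * length W                          ≡⟨ *-suc σ (length W) ⟨
  σ * suc (length W)                        ≤⟨ *-monoʳ-≤ σ (words≤-count A k 2≤σ) ⟩
  σ * σ ^ suc k                             ∎
  where
  open ≤-Reasoning
  W = words≤ A k
  σ = length A

∈-words≤ : ∀ A k (x : List ℕ) → All (_∈ A) x → length x ≤ k → x ∈ words≤ A k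
∈-words≤ A zero    []      _          _         = here refl
∈-words≤ A (suc k) []      _          _         = here refl
∈-words≤ A (suc k) (a ∷ x) (a∈A ∷ x∈A) (s≤s |x|≤k) =
  there (∈-cartesianProductWith⁺ _∷_ a∈A (∈-words≤ A k x x∈A |x|≤k))

unique⊆⇒length≤ : ∀ {A : Set} {xs ys : List A} → Unique xs → All (_∈ ys) xs → length xs ≤ length ys
unique⊆⇒length≤ {xs = []}     _ _ = z≤n
unique⊆⇒length≤ {xs = x ∷ xs} {ys} (x∉xs ∷ uxs) (x∈ys ∷ xs⊆ys) with ∈-∃++ x∈ys
... | ys₁ , ys₂ , refl = subst (suc (length xs) ≤_) (sym (length-++-sucʳ ys₁ x ys₂))
                           (s≤s (unique⊆⇒length≤ uxs (remove x∉xs xs⊆ys)))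
  where
  remove : ∀ {zs} → All (x ≢_) zs → All (_∈ ys₁ ++ x ∷ ys₂) zs → All (_∈ ys₁ ++ ys₂) zs
  remove []           []           = []
  remove (x≢z ∷ x≢zs) (z∈ ∷ zs∈) with ∈-++⁻ ys₁ z∈
  ... | inj₁ z∈ys₁         = ∈-++⁺ˡ z∈ys₁ ∷ remove x≢zs zs∈
  ... | inj₂ (here z≡x)    = ⊥-elim (x≢z (sym z≡x))
  ... | inj₂ (there z∈ys₂) = ∈-++⁺ʳ ys₁ z∈ys₂ ∷ remove x≢zs zs∈

weight : (ℕ → ℕ) → List Triple → ℕ
weight w []                 = 0
weight w ((_ , ℓ , _) ∷ ts) = w ℓ + weight w ts

countAtLeast : ℕ → List ℕ → ℕ
countAtLeast T ls = length (filter (T ≤?_) ls)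

greedy-[]-at-end : ∀ {s q} → Greedy s q [] → q ≡ length s
greedy-[]-at-end done = refl

-- Rearrangements for an encoding phrase of weight x charged to one or to two greedy phrases.
charged-once : ∀ W A x → 2 * W + (A + x) ≤ 2 * (x + W) + A
charged-once W A x = subst (2 * W + (A + x) ≤_) (rearrange W A x) (m≤m+n _ x)
  where
  rearrange : ∀ W A x → 2 * W + (A + x) + x ≡ 2 * (x + W) + A
  rearrange = solve-∀

charged-twice : ∀ W A x → (A + x) + (2 * W + x) ≡ 2 * (x + W) + A
charged-twice = solve-∀

-- The weight w ℓ of a phrase length ℓ is assumed to be worth
-- at least log₂ (ℓ + 1) bits, i.e. ℓ + 1 ≤ 2 ^ w ℓ.  A budget of weight A then pays for
-- a stretch of r letters when r + 1 ≤ 2 ^ A, and budgets of consecutive phrases add up.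
module Charging (s : List ℕ) (w : ℕ → ℕ) (w-bits : ∀ ℓ → 1 ≤ ℓ → suc ℓ ≤ 2 ^ w ℓ) where

  budget-step : ∀ {r ℓ A} → 1 ≤ ℓ → suc r ≤ 2 ^ A → suc (r + ℓ) ≤ 2 ^ (A + w ℓ)
  budget-step {r} {ℓ} {A} 1≤ℓ r-paid = begin
    suc (r + ℓ)         ≡⟨ cong suc (+-comm r ℓ) ⟩
    suc (ℓ + r)         ≤⟨ s≤s (+-monoʳ-≤ ℓ (m≤m*n r (suc ℓ))) ⟩
    suc r * suc ℓ       ≤⟨ *-mono-≤ r-paid (w-bits ℓ 1≤ℓ) ⟩
    2 ^ A * 2 ^ w ℓ     ≡⟨ ^-distribˡ-+-* 2 A (w ℓ) ⟨
    2 ^ (A + w ℓ)       ∎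
    where open ≤-Reasoning

  suffix-budget : ∀ {p ts} → LZEnc s p ts → suc (length s ∸ p) ≤ 2 ^ weight w ts
  suffix-budget done = subst (λ x → suc x ≤ 1) (sym (n∸n≡0 (length s))) ≤-refl
  suffix-budget {p} (step {ℓ = ℓ} {ts = ts} vt L) =
    subst₂ (λ x y → suc x ≤ 2 ^ y) remaining (+-comm (weight w ts) (w ℓ))
      (budget-step {A = weight w ts} 1≤ℓ (suffix-budget L))
    where
    n = length s
    1≤ℓ = proj₁ (triple-bounds vt)
    ℓ≤n∸p : ℓ ≤ n ∸ p
    ℓ≤n∸p = subst (_≤ n ∸ p) (m+n∸m≡n p ℓ) (∸-monoˡ-≤ p (proj₂ (triple-bounds vt)))
    remaining : n ∸ (p + ℓ) + ℓ ≡ n ∸ p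
    remaining = trans (cong (_+ ℓ) (sym (∸-+-assoc n p ℓ))) (m∸n+n≡m ℓ≤n∸p)

  log-length≤weight : ∀ {ts} → LZEnc s 0 ts → ⌊log₂ length s ⌋ ≤ weight w ts
  log-length≤weight {ts} L = subst (⌊log₂ length s ⌋ ≤_) (⌊log₂[2^n]⌋≡n (weight w ts))
                               (⌊log₂⌋-mono-≤ (<⇒≤ (suffix-budget L)))

  module _ (t : ℕ) where

    T : ℕ
    T = 2 ^ (t ∸ 1)

    long-needs-t : ∀ {g A} → T ≤ g → suc g ≤ 2 ^ A → t ≤ A
    long-needs-t {g} {A} T≤g g-paid with t ∸ 1 <? A
    ... | yes t∸1<A = ≤-trans (m≤n+m∸n t 1) t∸1<A
    ... | no t∸1≮A  = ⊥-elim (<⇒≱ (≤-trans (s≤s T≤g) g-paid) (^-monoʳ-≤ 2 (≮⇒≥ t∸1≮A)))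

    close-phrase : ∀ {g B} gs → suc g ≤ 2 ^ B → t * countAtLeast T (g ∷ gs) ≤ B + t * countAtLeast T gs
    close-phrase {g} {B} gs g-paid with T ≤? g
    ... | yes T≤g = begin
      t * countAtLeast T (g ∷ gs)  ≡⟨ cong (λ xs → t * length xs) (filter-accept (T ≤?_) T≤g) ⟩
      t * suc (countAtLeast T gs)  ≡⟨ *-suc t _ ⟩
      t + t * countAtLeast T gs    ≤⟨ +-monoˡ-≤ _ (long-needs-t T≤g g-paid) ⟩
      B + t * countAtLeast T gs    ∎
      where open ≤-Reasoning
    ... | no T≰g = begin
      t * countAtLeast T (g ∷ gs)  ≡⟨ cong (λ xs → t * length xs) (filter-reject (T ≤?_) T≰g) ⟩
      t * countAtLeast T gs        ≤⟨ m≤n+m _ B ⟩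
      B + t * countAtLeast T gs    ∎
      where open ≤-Reasoning

    -- Greedy and encoding phrases are swept together from left to right.  Every encoding
    -- phrase overlaps at most two greedy phrases (straddle-covered), and its weight is
    -- charged to each of them; a long greedy phrase collects weight at least t.
    mutual
      -- At a common boundary of both parsings.
      charge : ∀ {p ts gs} → LZEnc s p ts → Greedy s p gs → t * countAtLeast T gs ≤ 2 * weight w ts
      charge {ts = ts} {gs = []}    _ _ = subst (_≤ 2 * weight w ts) (sym (*-zeroʳ t)) z≤n
      charge {p} {ts} {gs@(_ ∷ _)} L G =
        subst (t * countAtLeast T gs ≤_) (+-identityʳ _) (charge-inside L G (sym (+-identityʳ p)) z≤n ≤-refl)

      -- Inside a greedy phrase of length g starting at q: the encoding is at offset r ≤ g,
      -- and the encoding phrases overlapping [q, q + r) so far have total weight A paying for r.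
      charge-inside : ∀ {p ts q g gs r A} → LZEnc s p ts → Greedy s q (g ∷ gs)
        → p ≡ q + r → r ≤ g → suc r ≤ 2 ^ A → t * countAtLeast T (g ∷ gs) ≤ 2 * weight w ts + A
      charge-inside {ts = ts} {gs = gs} {A = A} L (step vp maximal rest) p≡ r≤g r-paid
        with m≤n⇒m<n∨m≡n r≤g
      ... | inj₁ r<g  = charge-open L vp maximal rest p≡ r<g r-paid
      ... | inj₂ refl = begin
        t * countAtLeast T (_ ∷ gs)   ≤⟨ close-phrase gs r-paid ⟩
        A + t * countAtLeast T gs     ≤⟨ +-monoʳ-≤ A (charge L (subst (λ x → Greedy s x gs) (sym p≡) rest)) ⟩
        A + 2 * weight w ts           ≡⟨ +-comm A _ ⟩
        2 * weight w ts + A           ∎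
        where open ≤-Reasoning

      charge-open : ∀ {p ts q g gs r A} → LZEnc s p ts → ValidPhrase s q g
        → (∀ ℓ′ → ValidPhrase s q ℓ′ → ℓ′ ≤ g) → Greedy s (q + g) gs
        → p ≡ q + r → r < g → suc r ≤ 2 ^ A → t * countAtLeast T (g ∷ gs) ≤ 2 * weight w ts + A
      charge-open {q = q} done vp _ _ p≡ r<g _ =
        ⊥-elim (<⇒≱ (subst (_< q + _) (sym p≡) (+-monoʳ-< q r<g)) (proj₂ (phrase-bounds vp)))
      charge-open {p} {q = q} {g} {gs} {r} {A} (step {ℓ = ℓ} {ts = ts} vt L) vp maximal rest p≡ r<g r-paid
        with r + ℓ ≤? g
      ... | yes fits = ≤-trans
        (charge-inside L (step vp maximal rest) end≡ fits (budget-step {A = A} 1≤ℓ r-paid))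
        (charged-once (weight w ts) A (w ℓ))
        where
        1≤ℓ = proj₁ (triple-bounds vt)
        end≡ : p + ℓ ≡ q + (r + ℓ)
        end≡ = trans (cong (_+ ℓ) p≡) (+-assoc q r ℓ)
      ... | no overflows = ≤-trans
        (charge-straddle {B = A + w ℓ} vt L rest p<q+g q+g<end g-paid)
        (≤-reflexive (charged-twice (weight w ts) A (w ℓ)))
        where
        1≤ℓ = proj₁ (triple-bounds vt)
        p<q+g : p < q + g
        p<q+g = subst (_< q + g) (sym p≡) (+-monoʳ-< q r<g)
        q+g<end : q + g < p + ℓ
        q+g<end = subst (q + g <_) (sym (trans (cong (_+ ℓ) p≡) (+-assoc q r ℓ))) (+-monoʳ-< q (≰⇒> overflows))
        g-paid : suc g ≤ 2 ^ (A + w ℓ)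
        g-paid = ≤-trans (s≤s (<⇒≤ (≰⇒> overflows))) (budget-step {A = A} 1≤ℓ r-paid)

      -- An encoding phrase [p, p + ℓ) straddles the end of the current greedy phrase, which
      -- is paid by B; the next greedy phrase covers the rest of [p, p + ℓ)
      -- (straddle-covered), so it starts with offset r′ ≤ ℓ paid by the budget w ℓ.
      charge-straddle : ∀ {p d ℓ c ts q g gs B} → ValidTriple s p (d , ℓ , c) → LZEnc s (p + ℓ) ts
        → Greedy s (q + g) gs → p < q + g → q + g < p + ℓ → suc g ≤ 2 ^ B
        → t * countAtLeast T (g ∷ gs) ≤ B + (2 * weight w ts + w ℓ)
      charge-straddle {gs = []} vt _ rest _ q+g<end _ =
        ⊥-elim (<⇒≱ (<-≤-trans q+g<end (proj₂ (triple-bounds vt))) (≤-reflexive (sym (greedy-[]-at-end rest))))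
      charge-straddle {p} {ℓ = ℓ} {ts = ts} {q} {g} {g₂ ∷ gs} {B} vt L rest@(step vp₂ maximal₂ _) p<q+g q+g<end g-paid
        with m≤n⇒∃[o]m+o≡n (<⇒≤ q+g<end)
      ... | r′ , r′≡ = begin
        t * countAtLeast T (g ∷ g₂ ∷ gs)  ≤⟨ close-phrase (g₂ ∷ gs) g-paid ⟩
        B + t * countAtLeast T (g₂ ∷ gs)  ≤⟨ +-monoʳ-≤ B (charge-inside L rest (sym r′≡) r′≤g₂ r′-paid) ⟩
        B + (2 * weight w ts + w ℓ)       ∎
        where
        open ≤-Reasoning
        r′≤g₂ : r′ ≤ g₂
        r′≤g₂ = +-cancelˡ-≤ (q + g) r′ g₂ (subst (_≤ q + g + g₂) (sym r′≡)
                  (straddle-covered vt p<q+g q+g<end (proj₁ (phrase-bounds vp₂)) maximal₂))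
        r′≤ℓ : r′ ≤ ℓ
        r′≤ℓ = +-cancelˡ-≤ (q + g) r′ ℓ (subst (_≤ q + g + ℓ) (sym r′≡) (+-monoˡ-≤ ℓ (<⇒≤ p<q+g)))
        r′-paid : suc r′ ≤ 2 ^ w ℓ
        r′-paid = ≤-trans (s≤s r′≤ℓ) (w-bits ℓ (proj₁ (triple-bounds vt)))

shortInner : ℕ → List ℕ → ℕ → List ℕ → List (List ℕ)
shortInner T s q ls = filter (λ x → length x <? T) (innerPhrases s q ls)

short-or-long : ∀ T (x : List ℕ) ws (ls : List ℕ)
  → length (filter (λ y → length y <? T) (x ∷ ws)) + countAtLeast T (length x ∷ ls)
    ≡ suc (length (filter (λ y → length y <? T) ws) + countAtLeast T ls)
short-or-long T x ws ls with length x <? T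
... | yes short = cong₂ (λ xs ys → length xs + length ys)
                        (filter-accept (λ y → length y <? T) short) (filter-reject (T ≤?_) (<⇒≱ short))
... | no long   = trans (cong₂ (λ xs ys → length xs + length ys)
                               (filter-reject (λ y → length y <? T) long) (filter-accept (T ≤?_) (≮⇒≥ long)))
                        (+-suc _ _)

phrases-split : ∀ T {s q ls} → Greedy s q ls
  → length ls ≤ suc (length (shortInner T s q ls) + countAtLeast T ls)
phrases-split T done = z≤n
phrases-split T (step {ls = []} _ _ _) = s≤s z≤n
phrases-split T {s} {q} (step {ℓ = g} {ls = ls@(_ ∷ _)} vp _ rest) =
  s≤s (subst (length ls ≤_) (sym split) (phrases-split T rest))
  where
  -- The first word take g (drop q s) has length g since the phrase lies inside s.
  split : length (shortInner T s q (g ∷ ls)) + countAtLeast T (g ∷ ls)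
        ≡ suc (length (shortInner T s (q + g) ls) + countAtLeast T ls)
  split = subst (λ h → length (shortInner T s q (g ∷ ls)) + countAtLeast T (h ∷ ls)
                       ≡ suc (length (shortInner T s (q + g) ls) + countAtLeast T ls))
                (length-window g q s (proj₂ (phrase-bounds vp)))
                (short-or-long T (take g (drop q s)) (innerPhrases s (q + g) ls) ls)

innerPhrases-over : ∀ {A} s q ls → All (_∈ A) s → All (All (_∈ A)) (innerPhrases s q ls)
innerPhrases-over s q []               _   = []
innerPhrases-over s q (g ∷ [])         _   = []
innerPhrases-over s q (g ∷ ls@(_ ∷ _)) s∈A = take⁺ g (drop⁺ q s∈A) ∷ innerPhrases-over s (q + g) ls s∈A

-- The short inner phrases of a greedy parsing are distinct words of length < T over A,
-- so there are fewer than |A| ^ T of them.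
few-short-phrases : ∀ {A s q ls T} → 1 ≤ T → 2 ≤ length A → All (_∈ A) s → Greedy s q ls
  → length (shortInner T s q ls) < length A ^ T
few-short-phrases {A} {s} {q} {ls} {suc k} _ 2≤σ s∈A G = <-≤-trans
  (s≤s (unique⊆⇒length≤ (Unique-filter⁺ _ (innerPhrases-unique G)) short⊆words))
  (words≤-count A k 2≤σ)
  where
  short⊆words : All (_∈ words≤ A k) (shortInner (suc k) s q ls)
  short⊆words = All.zipWith (λ (x∈A , short) → ∈-words≤ A k _ x∈A (≤-pred short))
    (All-filter⁺ _ (innerPhrases-over s q ls s∈A) , all-filter _ (innerPhrases s q ls))

module Counting (s : List ℕ) (w : ℕ → ℕ) (w-bits : ∀ ℓ → 1 ≤ ℓ → suc ℓ ≤ 2 ^ w ℓ) {ls ts}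
  (G : Greedy s 0 ls) (L : LZEnc s 0 ts) where

  open Charging s w w-bits using (charge)

  -- Weighted by any t, the phrases are paid by t (the last phrase), the short inner
  -- phrases, and the long ones, which cost at most 2 W by the charging argument.
  weighted-count : ∀ t
    → length ls * t ≤ t + (length (shortInner (2 ^ (t ∸ 1)) s 0 ls) * t + 2 * weight w ts)
  weighted-count t = begin
    length ls * t         ≤⟨ *-monoˡ-≤ t (phrases-split T G) ⟩
    (1 + (S + N)) * t     ≡⟨ distribute S N t ⟩
    t + (S * t + t * N)   ≤⟨ +-monoʳ-≤ t (+-monoʳ-≤ (S * t) (charge t L G)) ⟩
    t + (S * t + 2 * weight w ts) ∎
    where
    open ≤-Reasoning
    T = 2 ^ (t ∸ 1)
    S = length (shortInner T s 0 ls)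
    N = countAtLeast T ls
    distribute : ∀ S N t → (1 + (S + N)) * t ≡ t + (S * t + t * N)
    distribute = solve-∀

  -- With t = 1 every phrase is long, so z ≤ 2 W.
  phrases≤2W : length ls ≤ 2 * weight w ts
  phrases≤2W = begin
    length ls              ≡⟨ cong length (filter-all (1 ≤?_) (greedy-nonempty G)) ⟨
    countAtLeast 1 ls      ≡⟨ *-identityˡ _ ⟨
    1 * countAtLeast 1 ls  ≤⟨ charge 1 L G ⟩
    2 * weight w ts        ∎
    where open ≤-Reasoning

  -- With t = ⌊log₂ ⌊log_σ z⌋⌋ ≥ 1 and threshold T = 2 ^ (t - 1), u = σ ^ T satisfies
  -- t ≤ T ≤ u and u * u ≤ z; there are fewer than u short phrases, so z · t ≤ 3 · 2 W.
  loglog-count : ∀ {σ A} → 2 ≤ σ → length A ≡ σ → All (_∈ A) s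
    → length ls * ⌊log₂ ⌊log[ σ ] length ls ⌋ ⌋ ≤ 3 * (2 * weight w ts)
  loglog-count {σ} {A} 2≤σ |A|≡σ s∈A with ⌊log₂ ⌊log[ σ ] length ls ⌋ ⌋ in t≡
  ... | zero   = subst (_≤ 3 * (2 * weight w ts)) (sym (*-zeroʳ (length ls))) z≤n
  ... | suc t′ = begin
    z * t             ≤⟨ weighted-count t ⟩
    t + (S * t + X)   ≤⟨ +-mono-≤ t≤z (+-monoˡ-≤ X S*t≤z) ⟩
    z + (z + X)       ≤⟨ +-mono-≤ phrases≤2W (+-monoˡ-≤ X phrases≤2W) ⟩
    X + (X + X)       ≡⟨ cong (λ y → X + (X + y)) (+-identityʳ X) ⟨
    3 * X             ∎
    where
    open ≤-Reasoning
    instance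
      σ≢0 : NonZero σ
      σ≢0 = >-nonZero (≤-trans (s≤s z≤n) 2≤σ)
    z = length ls
    t = suc t′
    T = 2 ^ t′
    u = σ ^ T
    X = 2 * weight w ts
    S = length (shortInner T s 0 ls)
    uu≤z : u * u ≤ z
    uu≤z = square-below σ z t′ t≡
    S<u : S < u
    S<u = subst (λ a → S < a ^ T) |A|≡σ (few-short-phrases (m^n>0 2 t′) (subst (2 ≤_) (sym |A|≡σ) 2≤σ) s∈A G)
    t≤u : t ≤ u
    t≤u = ≤-trans (n<2^n t′) (<⇒≤ (<-≤-trans (n<2^n T) (^-monoˡ-≤ T 2≤σ)))
    u≤z : u ≤ z
    u≤z = ≤-trans (≤-reflexive (sym (*-identityʳ u))) (≤-trans (*-monoʳ-≤ u (≤-trans (s≤s z≤n) t≤u)) uu≤z)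
    t≤z : t ≤ z
    t≤z = ≤-trans t≤u u≤z
    S*t≤z : S * t ≤ z
    S*t≤z = ≤-trans (*-mono-≤ (<⇒≤ S<u) t≤u) uu≤z

weighted-bound : ∀ (w : ℕ → ℕ) → (∀ ℓ → 1 ≤ ℓ → suc ℓ ≤ 2 ^ w ℓ)
  → ∀ {σ A s ls ts} → 2 ≤ σ → length A ≡ σ → All (_∈ A) s → Greedy s 0 ls → LZEnc s 0 ts
  → ⌊log₂ length s ⌋ + length ls * ⌊log₂ ⌊log[ σ ] length ls ⌋ ⌋ ≤ 7 * weight w ts
weighted-bound w w-bits {s = s} {ls} {ts} 2≤σ |A|≡σ s∈A G L = begin
  ⌊log₂ length s ⌋ + length ls * _  ≤⟨ +-mono-≤ (log-length≤weight L) (loglog-count 2≤σ |A|≡σ s∈A) ⟩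
  W + 3 * (2 * W)                   ≡⟨ seven W ⟩
  7 * W                             ∎
  where
  open ≤-Reasoning
  open Charging s w w-bits using (log-length≤weight)
  open Counting s w w-bits G L using (loglog-count)
  W = weight w ts
  seven : ∀ W → W + 3 * (2 * W) ≡ 7 * W
  seven = solve-∀

encoder-bits : ∀ (e : ℕ → List Bool) a → (∀ x → 1 ≤ x → ⌊log₂ suc x ⌋ ≤ a * length (e x))
  → ∀ ℓ → 1 ≤ ℓ → suc ℓ ≤ 2 ^ (suc a * length (e ℓ))
encoder-bits e a lower ℓ 1≤ℓ =
  <⇒≤ (<-≤-trans (<2^suc⌊log₂⌋ (suc ℓ)) (^-monoʳ-≤ 2 (+-mono-≤ 1≤|eℓ| (lower ℓ 1≤ℓ))))
  where
  1≤a*|eℓ| : 1 ≤ a * length (e ℓ)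
  1≤a*|eℓ| = ≤-trans (⌊log₂⌋-mono-≤ {2} (s≤s 1≤ℓ)) (lower ℓ 1≤ℓ)
  1≤|eℓ| : 1 ≤ length (e ℓ)
  1≤|eℓ| = >-nonZero⁻¹ _ {{m*n≢0⇒n≢0 a {{>-nonZero 1≤a*|eℓ|}}}}

weight≤encSize : ∀ ed eℓ ec c ts → weight (λ ℓ → c * length (eℓ ℓ)) ts ≤ c * encSize ed eℓ ec ts
weight≤encSize ed eℓ ec c [] = z≤n
weight≤encSize ed eℓ ec c ((d , ℓ , x) ∷ ts) = begin
  c * length (eℓ ℓ) + weight _ ts            ≤⟨ +-mono-≤ (*-monoʳ-≤ c ℓ-bits) (weight≤encSize ed eℓ ec c ts) ⟩
  c * triple-bits + c * encSize ed eℓ ec ts  ≡⟨ *-distribˡ-+ c triple-bits _ ⟨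
  c * encSize ed eℓ ec ((d , ℓ , x) ∷ ts)    ∎
  where
  open ≤-Reasoning
  triple-bits = length (ed d) + length (eℓ ℓ) + length (ec x)
  ℓ-bits : length (eℓ ℓ) ≤ triple-bits
  ℓ-bits = ≤-trans (m≤n+m _ (length (ed d))) (m≤m+n _ (length (ec x)))

lemma6 : (ed eℓ ec : ℕ → List Bool)
    → ThetaLogEncoder ed → ThetaLogEncoder eℓ → ThetaLogEncoder ec
    → ∃ λ k → ∃ λ n₀ →
    ∀ (n σ : ℕ) (A s : List ℕ) (ls : List ℕ) (ts : List Triple)
    → length s ≡ n → n₀ ≤ n → 2 ≤ σ → Alphabet n σ A s
    → GreedyParsing s ls → LZ77Encoding s ts
    → ⌊log₂ n ⌋ + length ls * ⌊log₂ ⌊log[ σ ] length ls ⌋ ⌋ ≤ k * encSize ed eℓ ec ts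
lemma6 ed eℓ ec _ (a , _ , eℓ-bounds) _ = 7 * suc a , 0 , bound
  where
  w : ℕ → ℕ
  w ℓ = suc a * length (eℓ ℓ)
  bound : ∀ n σ A s ls ts → length s ≡ n → 0 ≤ n → 2 ≤ σ → Alphabet n σ A s
    → GreedyParsing s ls → LZ77Encoding s ts
    → ⌊log₂ n ⌋ + length ls * ⌊log₂ ⌊log[ σ ] length ls ⌋ ⌋ ≤ 7 * suc a * encSize ed eℓ ec ts
  bound _ σ A s ls ts refl _ 2≤σ (_ , |A|≡σ , _ , s∈A) G L = begin
    ⌊log₂ length s ⌋ + length ls * _  ≤⟨ weighted-bound w (encoder-bits eℓ a (λ x 1≤x → proj₁ (eℓ-bounds x 1≤x))) 2≤σ |A|≡σ s∈A G L ⟩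
    7 * weight w ts                   ≤⟨ *-monoʳ-≤ 7 (weight≤encSize ed eℓ ec (suc a) ts) ⟩
    7 * (suc a * encSize ed eℓ ec ts) ≡⟨ *-assoc 7 (suc a) _ ⟨
    7 * suc a * encSize ed eℓ ec ts   ∎
    where open ≤-Reasoning
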